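{- Let $G_\tau$ be a bidirected graph and $\mathrm{Rt}(G_\tau)$ a transitive reduction of $G_\tau$. Then $r(M(\mathrm{Ft}(G_\tau)))=r(M(G_\tau))=r(M(\mathrm{Rt}(G_\tau)))$, where $r$ denotes the rank of the matroid.
   Context: A graph $G=(V,E)$ is finite, with loops and multiple edges allowed. A half-edge is a pair $(e,x)$ with $e$ incident with $x$ (a loop has two half-edges at its vertex). A bidirected graph $G_\tau=(V,E;\tau)$ is a graph with a map $\tau$ assigning $+1$ or $-1$ to every half-edge; an edge with ends $x,y$ and $\tau(e,x)=\alpha,\tau(e,y)=\beta$ is written $\{x^\alpha,y^\beta\}$ and has sign $-\alpha\beta$; a cycle is positive if it has an even number of negative edges and negative otherwise. The matroid $M(G_\tau)$ is the matroid on $E$ whose circuits are exactly: the edge sets of positive cycles; unions of two negative cycles having exactly one common vertex; and unions of two vertex-disjoint negative cycles together with an elementary chain joining them that is internally disjoint from both. Its rank is $|V|-b(G_\tau)$, where $b(G_\tau)$ is the number of connected components all of whose cycles are positive. A partial graph of $G_\tau$ is $(V,F;\tau|_F)$ with $F\subseteq E$. A chain is $x_0,e_1,x_1,\ldots,e_k,x_k$ where $e_i$ has ends $x_{i-1},x_i$; when $e_i$ is traversed from $x_{i-1}$ to $x_i$, $\tau(e_i,x_{i-1}),\tau(e_i,x_i)$ denote the values at the corresponding half-edges. For $\alpha,\beta\in\{\pm1\}$ a b-walk from $x^\alpha$ to $y^\beta$ is a chain $x=x_0,e_1,\ldots,e_k,x_k=y$ with $k\ge1$, $\tau(e_1,x_0)=\alpha$,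 $\tau(e_k,x_k)=\beta$ and $\tau(e_i,x_i)+\tau(e_{i+1},x_i)=0$ for $1\le i\le k-1$. A b-path from $x^\alpha$ to $y^\beta$ is a b-walk from $x^\alpha$ to $y^\beta$ minimal with these properties (no b-walk from $x^\alpha$ to $y^\beta$ has as edge sequence a proper subsequence, in the same order, of its edge sequence); $x=y$ allowed. The transitive closure $\mathrm{Ft}(G_\tau)$ is the bidirected graph on $V$ whose edges are those of $G_\tau$ together with an edge $\{x^\alpha,y^\beta\}$ (a loop if $x=y$) for every $x^\alpha,y^\beta$ such that $G_\tau$ has a b-path from $x^\alpha$ to $y^\beta$. For a partial graph $H_\tau$ of $G_\tau$, $\mathrm{ft}(G_\tau;H_\tau)$ is the partial graph of $G_\tau$ whose edges are the edges of $G_\tau$ that are edges of $H_\tau$ or are of the form $\{x^\alpha,y^\beta\}$ with a b-path from $x^\alpha$ to $y^\beta$ in $H_\tau$. A transitive reduction of $G_\tau$ is a minimal partial graph $R$ of $G_\tau$ with $\mathrm{ft}(G_\tau;R)=G_\tau$. -}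

module Defs where

open import Data.Nat using (ℕ; _≤_; _<_)
open import Data.Fin using (Fin)
open import Data.Fin.Subset using (Subset; _∈_; _⊂_)
open import Data.Bool using (Bool; true; false)
open import Data.Unit using (⊤)
open import Data.List using (List; []; _∷_; map; length; _++_; foldr)
open import Data.List.Relation.Unary.All using (All)
open import Data.List.Relation.Unary.Linked using (Linked)
open import Data.List.Relation.Unary.Unique.Propositional using (Unique)
open import Data.List.Relation.Binary.Sublist.Propositional using () renaming (_⊆_ to _⊑_)
open import Data.List.Membership.Propositional using () renaming (_∈_ to _∈ₗ_; _∉_ to _∉ₗ_)
open import Data.Product using (Σ; _×_; _,_)
open import Data.Sum using (_⊎_; inj₁; inj₂)
open import Relation.Binary.PropositionalEquality using (_≡_)
open import Relation.Nullary using (¬_)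

data Sign : Set where
  plus minus : Sign

neg : Sign → Sign
neg plus = minus
neg minus = plus

_·_ : Sign → Sign → Sign
plus · s = s
minus · s = neg s

-- A bidirected edge {x^α , y^β}: ends x, y with τ(e,x) = α, τ(e,y) = β.

record Edge (n : ℕ) : Set where
  constructor mkEdge
  field
    x : Fin n
    α : Sign
    y : Fin n
    β : Sign

edgeSign : ∀ {n} → Edge n → Sign
edgeSign e = neg (Edge.α e · Edge.β e)

module OnEdges {n : ℕ} {X : Set} (lab : X → Edge n) where

  -- an edge traversed in one of its two directions
  -- (fwd = true : from x to y ; fwd = false : from y to x)
  record Step : Set where
    constructor step
    field
      edge : X
      fwd  : Bool

  src tgt : Step → Fin n
  src (step e true)  = Edge.x (lab e)
  src (step e false) = Edge.y (lab e)
  tgt (step e true)  = Edge.y (lab e)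
  tgt (step e false) = Edge.x (lab e)

  srcSign tgtSign : Step → Sign
  srcSign (step e true)  = Edge.α (lab e)
  srcSign (step e false) = Edge.β (lab e)
  tgtSign (step e true)  = Edge.β (lab e)
  tgtSign (step e false) = Edge.α (lab e)

  lastOf : Step → List Step → Step
  lastOf s []       = s
  lastOf s (t ∷ ts) = lastOf t ts

  edgesOf : Step → List Step → List X
  edgesOf s ss = map Step.edge (s ∷ ss)

  Adj : Step → Step → Set
  Adj s t = tgt s ≡ src t

  BAdj : Step → Step → Set
  BAdj s t = Adj s t × tgtSign s ≡ neg (srcSign t)

  record BWalk (S : X → Set) (a : Fin n) (α : Sign) (b : Fin n) (β : Sign) : Set where
    field
      first     : Step
      rest      : List Step
      inS       : All (λ s → S (Step.edge s)) (first ∷ rest)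
      linked    : Linked BAdj (first ∷ rest)
      start     : src first ≡ a
      startSign : srcSign first ≡ α
      stop      : tgt (lastOf first rest) ≡ b
      stopSign  : tgtSign (lastOf first rest) ≡ β

  bwalkEdges : ∀ {S a α b β} → BWalk S a α b β → List X
  bwalkEdges w = edgesOf (BWalk.first w) (BWalk.rest w)

  ProperSubseq : List X → List X → Set
  ProperSubseq xs ys = xs ⊑ ys × length xs < length ys

  IsBPath : ∀ S a α b β → BWalk S a α b β → Set
  IsBPath S a α b β w =
    (w' : BWalk S a α b β) → ¬ ProperSubseq (bwalkEdges w') (bwalkEdges w)

  HasBPath : (X → Set) → Fin n → Sign → Fin n → Sign → Set
  HasBPath S a α b β = Σ (BWalk S a α b β) (IsBPath S a α b β)

  record Cycle : Set where
    field
      first    : Step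
      rest     : List Step
      linked   : Linked Adj (first ∷ rest)
      closed   : tgt (lastOf first rest) ≡ src first
      edgesDistinct : Unique (edgesOf first rest)
      vertsDistinct : Unique (map src (first ∷ rest))

  cycleEdges : Cycle → List X
  cycleEdges C = edgesOf (Cycle.first C) (Cycle.rest C)

  cycleVerts : Cycle → List (Fin n)
  cycleVerts C = map src (Cycle.first C ∷ Cycle.rest C)

  cycleSign : Cycle → Sign
  cycleSign C = foldr _·_ plus (map (λ e → edgeSign (lab e)) (cycleEdges C))

  record ElemChain : Set where
    field
      first  : Step
      rest   : List Step
      linked : Linked Adj (first ∷ rest)
      elementary : Unique (src first ∷ map tgt (first ∷ rest))

  chainEdges : ElemChain → List X
  chainEdges P = edgesOf (ElemChain.first P) (ElemChain.rest P)

  chainStart chainEnd : ElemChain → Fin n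
  chainStart P = src (ElemChain.first P)
  chainEnd   P = tgt (lastOf (ElemChain.first P) (ElemChain.rest P))

  chainInternal : ElemChain → List (Fin n)
  chainInternal P = map src (ElemChain.rest P)

  data CircuitWitness : Set where
    positiveCycle : (C : Cycle) → cycleSign C ≡ plus → CircuitWitness
    -- two (distinct, hence edge-disjoint) negative cycles with exactly one common vertex
    tightHandcuff : (C₁ C₂ : Cycle) → cycleSign C₁ ≡ minus → cycleSign C₂ ≡ minus →
      (∀ e → e ∈ₗ cycleEdges C₁ → e ∉ₗ cycleEdges C₂) →
      Σ (Fin n) (λ v → v ∈ₗ cycleVerts C₁ × v ∈ₗ cycleVerts C₂ ×
                       (∀ w → w ∈ₗ cycleVerts C₁ → w ∈ₗ cycleVerts C₂ → w ≡ v)) →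
      CircuitWitness
    looseHandcuff : (C₁ C₂ : Cycle) → cycleSign C₁ ≡ minus → cycleSign C₂ ≡ minus →
      (∀ w → w ∈ₗ cycleVerts C₁ → w ∉ₗ cycleVerts C₂) →
      (P : ElemChain) → chainStart P ∈ₗ cycleVerts C₁ → chainEnd P ∈ₗ cycleVerts C₂ →
      All (λ w → w ∉ₗ cycleVerts C₁ × w ∉ₗ cycleVerts C₂) (chainInternal P) →
      CircuitWitness

  circuitEdges : CircuitWitness → List X
  circuitEdges (positiveCycle C _) = cycleEdges C
  circuitEdges (tightHandcuff C₁ C₂ _ _ _ _) = cycleEdges C₁ ++ cycleEdges C₂
  circuitEdges (looseHandcuff C₁ C₂ _ _ _ P _ _ _) =
    cycleEdges C₁ ++ cycleEdges C₂ ++ chainEdges P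

  Independent : (Ground : X → Set) → List X → Set
  Independent Ground I =
    Unique I × All Ground I ×
    ¬ Σ CircuitWitness (λ c → All (_∈ₗ I) (circuitEdges c))

  IsRank : (Ground : X → Set) → ℕ → Set
  IsRank Ground k =
    Σ (List X) (λ I → Independent Ground I × length I ≡ k) ×
    ((I : List X) → Independent Ground I → length I ≤ k)

record BiGraph : Set where
  field
    n    : ℕ
    m    : ℕ
    edge : Fin m → Edge n

module _ (G : BiGraph) where
  open BiGraph G

  HasBPathIn : Subset m → Fin n → Sign → Fin n → Sign → Set
  HasBPathIn R = OnEdges.HasBPath edge (_∈ R)

  HasBPathG : Fin n → Sign → Fin n → Sign → Set
  HasBPathG = OnEdges.HasBPath edge (λ _ → ⊤)

  -- ft(G;R) = G : every edge of G is in R or is {x^α,y^β} with a b-path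
  -- from x^α to y^β in R (the edge {x^α,y^β} equals {y^β,x^α})
  FtCovers : Subset m → Set
  FtCovers R = (e : Fin m) → e ∈ R ⊎
    HasBPathIn R (Edge.x (edge e)) (Edge.α (edge e)) (Edge.y (edge e)) (Edge.β (edge e)) ⊎
    HasBPathIn R (Edge.y (edge e)) (Edge.β (edge e)) (Edge.x (edge e)) (Edge.α (edge e))

  IsTransitiveReduction : Subset m → Set
  IsTransitiveReduction R = FtCovers R × ((R' : Subset m) → R' ⊂ R → ¬ FtCovers R')

  -- edges of Ft(G): the edges of G, plus an edge {x^α,y^β} for each
  -- x^α, y^β having a b-path in G
  FtEdge : Set
  FtEdge = Fin m ⊎ Edge n

  ftLab : FtEdge → Edge n
  ftLab (inj₁ e) = edge e
  ftLab (inj₂ q) = q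

  FtGround : FtEdge → Set
  FtGround (inj₁ _) = ⊤
  FtGround (inj₂ q) = HasBPathG (Edge.x q) (Edge.α q) (Edge.y q) (Edge.β q)

  RankG : ℕ → Set
  RankG = OnEdges.IsRank edge (λ _ → ⊤)

  RankFt : ℕ → Set
  RankFt = OnEdges.IsRank ftLab FtGround

  RankPartial : Subset m → ℕ → Set
  RankPartial R = OnEdges.IsRank edge (_∈ R)

{-# OPTIONS --safe #-}

-- The edge {x^α,y^β} is represented by the vector α x + β y. Along a b-walk the inner terms
-- cancel, so Ft(G), G and any R with ft(G;R) = G span the same space. Linear algebra is reduced to
-- quotient maps h that send every vertex to 0 or to ± a basis vector: adding an edge outside the
-- span eliminates one basis vector, so a greedily chosen basis B of R and its quotient satisfy
-- |B| + k = n, where k is the dimension of the quotient. A circuit is linearly dependent, so B is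
-- circuit-free. Conversely let I be circuit-free with all its edges killed by h. Each component
-- of I has at most one cycle, which is negative and on which h vanishes; mapping the k basis
-- vectors and the edges outside a spanning forest to the trees of the forest is therefore
-- injective, and |I| + k ≤ n.

module Submission where

open import Defs
open import Data.Bool using (true; false; not)
open import Data.Empty using (⊥; ⊥-elim)
open import Data.Fin using (Fin; zero; suc; punchIn; punchOut; join; splitAt)
open import Data.Fin.Properties using (_≟_; punchInᵢ≢i; punchOut-cong; punchOut-punchIn; punchIn-punchOut; injective⇒≤; join-splitAt)
open import Data.Fin.Subset using (Subset) renaming (_∈_ to _∈ₛ_)
open import Data.Fin.Subset.Properties using () renaming (_∈?_ to _∈ₛ?_)
open import Data.List using (List; []; _∷_; [_]; map; _++_; length; foldr; lookup; filter; allFin)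
open import Data.List.Membership.DecPropositional using () renaming (_∈?_ to member?)
open import Data.List.Membership.Propositional using (_∈_; _∉_)
open import Data.List.Membership.Propositional.Properties using (∈-map⁺; ∈-map⁻; ∈-++⁺ˡ; ∈-++⁺ʳ; ∈-++⁻; ∈-lookup; ∈-filter⁺; ∈-filter⁻; ∈-allFin)
open import Data.List.Properties using (map-++; ++-assoc; length-map)
open import Data.List.Relation.Binary.Disjoint.Propositional using (Disjoint)
open import Data.List.Relation.Binary.Permutation.Propositional using (_↭_; ↭-refl; ↭-sym; ↭-trans; ↭-reflexive; ↭⇒↭ₛ)
open import Data.List.Relation.Binary.Permutation.Propositional.Properties using (++-comm; ++⁺ʳ; ∈-resp-↭)
import Data.List.Relation.Binary.Permutation.Setoid.Properties as PermSetoid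
open import Data.List.Relation.Unary.All as All using (All; []; _∷_)
import Data.List.Relation.Unary.All.Properties as Allₚ
open import Data.List.Relation.Unary.AllPairs using ([]; _∷_)
open import Data.List.Relation.Unary.Any using (here; there)
open import Data.List.Relation.Unary.Linked using (Linked; [-]; _∷_)
open import Data.List.Relation.Unary.Unique.Propositional using (Unique)
import Data.List.Relation.Unary.Unique.Propositional.Properties as Uniqueₚ
open import Data.Maybe using (Maybe; just; nothing)
open import Data.Nat using (ℕ; zero; suc; _+_; _≤_)
open import Data.Nat.Properties using (+-suc; +-comm; +-assoc; +-cancelʳ-≤; +-monoʳ-≤; module ≤-Reasoning)
open import Data.Product using (Σ; ∃; _×_; _,_; proj₁; proj₂)
open import Data.Sum using (_⊎_; inj₁; inj₂)
open import Function using (_∘_; id)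
open import Relation.Binary.PropositionalEquality using (_≡_; _≢_; refl; sym; trans; cong; cong₂; subst; setoid)
open import Relation.Nullary using (¬_; Dec; yes; no)

-- Lists without repetition

module _ {A : Set} where

  unique-++⁻ : ∀ (xs : List A) {ys} → Unique (xs ++ ys) → Unique xs × Unique ys × Disjoint xs ys
  unique-++⁻ []       u        = [] , u , λ { (() , _) }
  unique-++⁻ (x ∷ xs) (x∉ ∷ u) with unique-++⁻ xs u
  ... | uxs , uys , d = Allₚ.++⁻ˡ xs x∉ ∷ uxs , uys ,
    λ { (here refl , v∈ys) → All.lookup (Allₚ.++⁻ʳ xs x∉) v∈ys refl
      ; (there v∈xs , v∈ys) → d (v∈xs , v∈ys) }

  unique-resp-↭ : {xs ys : List A} → xs ↭ ys → Unique xs → Unique ys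
  unique-resp-↭ p = PermSetoid.Unique-resp-↭ (setoid A) (↭⇒↭ₛ p)

  unique-∷⁺ : ∀ {x : A} {xs} → x ∉ xs → Unique xs → Unique (x ∷ xs)
  unique-∷⁺ x∉xs u = Allₚ.¬Any⇒All¬ _ x∉xs ∷ u

  unique-∷⁻ : ∀ {x : A} {xs} → Unique (x ∷ xs) → x ∉ xs
  unique-∷⁻ (x∉ ∷ _) = Allₚ.All¬⇒¬Any x∉

  lookup-injective : ∀ {xs : List A} → Unique xs → ∀ i j → lookup xs i ≡ lookup xs j → i ≡ j
  lookup-injective {_ ∷ _} u       zero    zero    _  = refl
  lookup-injective {_ ∷ _} u       zero    (suc j) eq = ⊥-elim (unique-∷⁻ u (subst (_∈ _) (sym eq) (∈-lookup j)))
  lookup-injective {_ ∷ _} u       (suc i) zero    eq = ⊥-elim (unique-∷⁻ u (subst (_∈ _) eq (∈-lookup i)))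
  lookup-injective {_ ∷ _} (_ ∷ u) (suc i) (suc j) eq = cong suc (lookup-injective u i j eq)

-- Signed labellings

·-assoc : ∀ s t u → (s · t) · u ≡ s · (t · u)
·-assoc plus  t     u = refl
·-assoc minus plus  u = refl
·-assoc minus minus plus = refl
·-assoc minus minus minus = refl

·-comm : ∀ s t → s · t ≡ t · s
·-comm plus  plus  = refl
·-comm plus  minus = refl
·-comm minus plus  = refl
·-comm minus minus = refl

·-self : ∀ s → s · s ≡ plus
·-self plus  = refl
·-self minus = refl

·-identityʳ : ∀ s → s · plus ≡ s
·-identityʳ plus  = refl
·-identityʳ minus = refl

-- Meant for the two arcs of a negative cycle: since their signs differ, each sign is realised by
-- one of them.
·-opposite : ∀ s t → s · t ≡ minus → ∀ σ → s ≡ σ ⊎ t ≡ σ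
·-opposite plus  minus eq plus  = inj₁ refl
·-opposite plus  minus eq minus = inj₂ refl
·-opposite minus plus  eq plus  = inj₂ refl
·-opposite minus plus  eq minus = inj₁ refl

_≟ₛ_ : (s t : Sign) → Dec (s ≡ t)
plus  ≟ₛ plus  = yes refl
plus  ≟ₛ minus = no λ ()
minus ≟ₛ plus  = no λ ()
minus ≟ₛ minus = yes refl

-- The elements 0 and ±eᵢ (i < k) of a vector space with basis e₀, …, eₖ₋₁.

Val : ℕ → Set
Val k = Maybe (Sign × Fin k)

act : ∀ {k} → Sign → Val k → Val k
act s nothing        = nothing
act s (just (t , i)) = just (s · t , i)

act-· : ∀ {k} s t (v : Val k) → act s (act t v) ≡ act (s · t) v
act-· s t nothing        = refl
act-· s t (just (u , i)) = cong (λ w → just (w , i)) (sym (·-assoc s t u))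

act-plus : ∀ {k} (v : Val k) → act plus v ≡ v
act-plus nothing  = refl
act-plus (just _) = refl

act-flip : ∀ {k} s {u v : Val k} → u ≡ act s v → v ≡ act s u
act-flip s {v = v} refl = sym (trans (act-· s s v) (trans (cong (λ t → act t v) (·-self s)) (act-plus v)))

-- A signed basis vector differs from its negative, that is, the characteristic is not 2. This is
-- what makes labels vanish on negative cycles.
act-minus-fixed : ∀ {k} (v : Val k) → v ≡ act minus v → v ≡ nothing
act-minus-fixed nothing            _ = refl
act-minus-fixed (just (plus , _))  ()
act-minus-fixed (just (minus , _)) ()

_≟ᵥ_ : ∀ {k} (u v : Val k) → Dec (u ≡ v)
nothing        ≟ᵥ nothing        = yes refl
nothing        ≟ᵥ just _         = no λ ()
just _         ≟ᵥ nothing        = no λ ()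
just (s , i)   ≟ᵥ just (t , j) with s ≟ₛ t | i ≟ j
... | yes refl | yes refl = yes refl
... | no s≢t   | _        = no λ { refl → s≢t refl }
... | _        | no i≢j   = no λ { refl → i≢j refl }

Labelling : ℕ → ℕ → Set
Labelling n k = Fin n → Val k

-- Sat h {x^α,y^β} says α h(x) + β h(y) = 0.

Sat : ∀ {n k} → Labelling n k → Edge n → Set
Sat h e = h (Edge.x e) ≡ act (edgeSign e) (h (Edge.y e))

-- A quotient map on the space of the vertices. The representatives show that every one of the `k`
-- basis vectors is attained, so `k` is the dimension of the quotient.
record Labels (n k : ℕ) : Set where
  field
    lbl     : Labelling n k
    rep     : Fin k → Fin n
    lbl-rep : ∀ i → lbl (rep i) ≡ just (plus , i)

-- Elimination of a basis vector

module _ {k} (r : Fin (suc k)) (t : Val k) where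

  -- The linear map that substitutes `t` for the basis vector `r` and renumbers the others.
  eliminate : Val (suc k) → Val k
  eliminate nothing = nothing
  eliminate (just (s , i)) with r ≟ i
  ... | yes _   = act s t
  ... | no r≢i = just (s , punchOut r≢i)

  eliminate-act : ∀ s v → eliminate (act s v) ≡ act s (eliminate v)
  eliminate-act s nothing = refl
  eliminate-act s (just (u , i)) with r ≟ i
  ... | yes _ = sym (act-· s u t)
  ... | no _  = refl

  eliminate-pivot : ∀ s → eliminate (just (s , r)) ≡ act s t
  eliminate-pivot s with r ≟ r
  ... | yes _   = refl
  ... | no r≢r = ⊥-elim (r≢r refl)

  eliminate-other : ∀ s {i} (r≢i : r ≢ i) → eliminate (just (s , i)) ≡ just (s , punchOut r≢i)
  eliminate-other s {i} r≢i with r ≟ i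
  ... | yes r≡i = ⊥-elim (r≢i r≡i)
  ... | no _    = cong (λ j → just (s , j)) (punchOut-cong r refl)

  eliminate-labels : ∀ {n} → Labels n (suc k) → Labels n k
  eliminate-labels L = record
    { lbl = eliminate ∘ lbl
    ; rep = rep ∘ punchIn r
    ; lbl-rep = λ i → trans (cong eliminate (lbl-rep (punchIn r i)))
        (trans (eliminate-other plus (punchInᵢ≢i r i ∘ sym)) (cong (λ j → just (plus , j)) (punchOut-punchIn r)))
    }
    where open Labels L

  eliminate-sat : ∀ {n} {h : Labelling n (suc k)} e → Sat h e → Sat (eliminate ∘ h) e
  eliminate-sat {h = h} e p = trans (cong eliminate p) (eliminate-act _ (h (Edge.y e)))

-- Two different values exist only when `k` is positive, so the predecessor of `k` is part of the
-- data.
record Elimination {k} (u v : Val k) : Set where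
  constructor elimination
  field
    {k′}  : ℕ
    k≡    : k ≡ suc k′
    pivot : Fin (suc k′)
    value : Val k′
    glues : eliminate pivot value (subst Val k≡ u) ≡ eliminate pivot value (subst Val k≡ v)

-- If one value is zero, or both are opposite multiples of the same basis vector, that vector is
-- sent to zero. Otherwise one basis vector becomes a signed copy of the other.
eliminates : ∀ {k} (u v : Val k) → u ≢ v → Elimination u v
eliminates nothing nothing u≢v = ⊥-elim (u≢v refl)
eliminates {suc k} nothing (just (s , r)) _ = elimination refl r nothing (sym (eliminate-pivot r nothing s))
eliminates {suc k} (just (s , r)) nothing _ = elimination refl r nothing (eliminate-pivot r nothing s)
eliminates {suc k} (just (s , r)) (just (t , i)) u≢v with r ≟ i
... | yes refl = elimination refl r nothing
      (trans (eliminate-pivot r nothing s) (sym (eliminate-pivot r nothing t)))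
... | no r≢i = elimination refl r (act s (just (t , punchOut r≢i)))
      (trans (eliminate-pivot r _ s)
        (trans (sym (act-flip s refl)) (sym (eliminate-other r _ t r≢i))))

-- The vector of `e` is nonzero in the quotient, so dividing by it costs exactly one dimension.
-- Earlier equations survive because elimination commutes with signs.
addEdge : ∀ {n k} (L : Labels n k) (e : Edge n) → ¬ Sat (Labels.lbl L) e →
  ∃ λ k′ → k ≡ suc k′ × Σ (Labels n k′) λ L′ →
    Sat (Labels.lbl L′) e × (∀ f → Sat (Labels.lbl L) f → Sat (Labels.lbl L′) f)
addEdge L e unsat with eliminates (Labels.lbl L (Edge.x e)) (act (edgeSign e) (Labels.lbl L (Edge.y e))) unsat
... | elimination {k′} refl r t glued = k′ , refl , eliminate-labels r t L ,
  trans glued (eliminate-act r t _ (Labels.lbl L (Edge.y e))) , eliminate-sat r t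

-- Chains, their vertices and their signs

module Chains {n : ℕ} {X : Set} (lab : X → Edge n) where
  open OnEdges lab

  -- Unlike the nonempty linked lists in the definition of cycles, these chains may be empty and
  -- carry both ends as indices, so that they can be cut and joined by structural recursion.
  data Chain : Fin n → List Step → Fin n → Set where
    nil  : ∀ {a b} → a ≡ b → Chain a [] b
    cons : ∀ {a b s ss} → src s ≡ a → Chain (tgt s) ss b → Chain a (s ∷ ss) b

  sgn : Step → Sign
  sgn s = edgeSign (lab (Step.edge s))

  chainSign : List Step → Sign
  chainSign p = foldr _·_ plus (map (λ e → edgeSign (lab e)) (map Step.edge p))

  verts : List Step → Fin n → List (Fin n)
  verts p b = map src p ++ [ b ]

  chain-++ : ∀ {a b c p q} → Chain a p b → Chain b q c → Chain a (p ++ q) c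
  chain-++ (nil refl)    d = d
  chain-++ (cons eq c) d = cons eq (chain-++ c d)

  chain-++⁻ : ∀ p {a b q} → Chain a (p ++ q) b → ∃ λ v → Chain a p v × Chain v q b
  chain-++⁻ []      c           = _ , nil refl , c
  chain-++⁻ (s ∷ p) (cons eq c) with chain-++⁻ p c
  ... | v , c₁ , c₂ = v , cons eq c₁ , c₂

  linked⇒chain : ∀ {s ss} → Linked Adj (s ∷ ss) → Chain (src s) (s ∷ ss) (tgt (lastOf s ss))
  linked⇒chain {ss = []}     [-]      = cons refl (nil refl)
  linked⇒chain {ss = t ∷ ss} (st ∷ l) with linked⇒chain l
  ... | cons _ c = cons refl (cons (sym st) c)

  chain⇒linked : ∀ {a b s ss} → Chain a (s ∷ ss) b → Linked Adj (s ∷ ss) × tgt (lastOf s ss) ≡ b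
  chain⇒linked (cons _ (nil eq)) = [-] , eq
  chain⇒linked (cons _ (cons eq c)) with chain⇒linked (cons eq c)
  ... | l , last = sym eq ∷ l , last

  chainSign-++ : ∀ p q → chainSign (p ++ q) ≡ chainSign p · chainSign q
  chainSign-++ []      q = refl
  chainSign-++ (s ∷ p) q = trans (cong (sgn s ·_) (chainSign-++ p q)) (sym (·-assoc (sgn s) _ _))

  start∈verts : ∀ {a b p} → Chain a p b → a ∈ verts p b
  start∈verts (nil eq)    = here eq
  start∈verts (cons eq _) = here (sym eq)

  end∈verts : ∀ p {b} → b ∈ verts p b
  end∈verts p = ∈-++⁺ʳ (map src p) (here refl)

  verts-tgt : ∀ {a b p} → Chain a p b → a ∷ map tgt p ≡ verts p b
  verts-tgt (nil refl)       = refl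
  verts-tgt (cons {s = s} refl c) = cong (src s ∷_) (verts-tgt c)

  verts-++ : ∀ p q b → verts (p ++ q) b ≡ map src p ++ verts q b
  verts-++ p q b = trans (cong (_++ [ b ]) (map-++ src p q)) (++-assoc (map src p) (map src q) [ b ])

  tgt∈verts : ∀ {a b p t} → Chain a p b → t ∈ p → tgt t ∈ verts p b
  tgt∈verts {t = t} c t∈p = subst (tgt t ∈_) (verts-tgt c) (there (∈-map⁺ tgt t∈p))

  src∈verts : ∀ {b p t} → t ∈ p → src t ∈ verts p b
  src∈verts t∈p = ∈-++⁺ˡ (∈-map⁺ src t∈p)

  record Split (a : Fin n) (p : List Step) (b v : Fin n) : Set where
    constructor split
    field
      pre post : List Step
      eq       : p ≡ pre ++ post
      toV      : Chain a pre v
      fromV    : Chain v post b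

  extend : ∀ {a b v s p} → src s ≡ a → Split (tgt s) p b v → Split a (s ∷ p) b v
  extend {s = s} src≡ S = split (s ∷ pre) post (cong (s ∷_) eq) (cons src≡ toV) fromV
    where open Split S

  splitAtVertex : ∀ {a b v p} → Chain a p b → v ∈ verts p b → Split a p b v
  splitAtVertex (nil refl) (here refl) = split [] [] refl (nil refl) (nil refl)
  splitAtVertex (cons refl c) (here refl) = split [] _ refl (nil refl) (cons refl c)
  splitAtVertex (cons eq c) (there v∈) = extend eq (splitAtVertex c v∈)

  _∈ᵥ?_ : (v : Fin n) (L : List (Fin n)) → Dec (v ∈ L)
  _∈ᵥ?_ = member? _≟_

  module _ (L : List (Fin n)) where

    -- The sources of `pre` are the vertices before `v`, so their avoiding `L` makes `v` the first
    -- vertex in `L`.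
    firstHit : ∀ {a b p} → Chain a p b → All (_∉ L) (verts p b) ⊎
      (∃ λ v → Σ (Split a p b v) λ S → v ∈ L × All (_∉ L) (map src (Split.pre S)))
    firstHit {b = b} (nil refl) with b ∈ᵥ? L
    ... | yes b∈L = inj₂ (b , split [] [] refl (nil refl) (nil refl) , b∈L , [])
    ... | no b∉L  = inj₁ (b∉L ∷ [])
    firstHit (cons {s = s} eq c) with src s ∈ᵥ? L
    ... | yes s∈L = inj₂ (src s , split [] _ refl (nil (sym eq)) (cons refl c) , s∈L , [])
    ... | no s∉L with firstHit c
    ...   | inj₁ avoids             = inj₁ (s∉L ∷ avoids)
    ...   | inj₂ (v , S , v∈L , av) = inj₂ (v , extend eq S , v∈L , s∉L ∷ av)

    -- Here the targets of `post` are the vertices after `v`, which makes `v` the last vertex in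
    -- `L`.
    lastHit : ∀ {a b p} → Chain a p b → All (_∉ L) (verts p b) ⊎
      (∃ λ v → Σ (Split a p b v) λ S → v ∈ L × All (_∉ L) (map tgt (Split.post S)))
    lastHit {b = b} (nil refl) with b ∈ᵥ? L
    ... | yes b∈L = inj₂ (b , split [] [] refl (nil refl) (nil refl) , b∈L , [])
    ... | no b∉L  = inj₁ (b∉L ∷ [])
    lastHit (cons {s = s} eq c) with lastHit c
    ... | inj₂ (v , S , v∈L , av) = inj₂ (v , extend eq S , v∈L , av)
    ... | inj₁ avoids with src s ∈ᵥ? L
    ...   | yes s∈L = inj₂ (src s , split [] _ refl (nil (sym eq)) (cons refl c) , s∈L ,
                            subst (All (_∉ L)) (sym (verts-tgt c)) avoids)
    ...   | no s∉L  = inj₁ (s∉L ∷ avoids)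

  -- If the new source already lies on the erased remainder, the loop is dropped by restarting from
  -- that occurrence.
  loopErase : ∀ {a b p} → Chain a p b →
    ∃ λ q → Chain a q b × Unique (verts q b) × (∀ {t} → t ∈ q → t ∈ p)
  loopErase (nil refl) = [] , nil refl , [] ∷ [] , λ ()
  loopErase {b = b} (cons {s = s} refl c) with loopErase c
  ... | q , d , u , sub with src s ∈ᵥ? verts q b
  ...   | no s∉ = s ∷ q , cons refl d , unique-∷⁺ s∉ u ,
                  λ { (here eq) → here eq ; (there t∈) → there (sub t∈) }
  ...   | yes s∈ with splitAtVertex d s∈
  ...     | split q₁ q₂ refl _ d₂ = q₂ , d₂ ,
              proj₁ (proj₂ (unique-++⁻ (map src q₁) (subst Unique (verts-++ q₁ q₂ b) u))) ,
              λ t∈ → there (sub (∈-++⁺ʳ q₁ t∈))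

  -- Reversal

  flip : Step → Step
  flip (step e d) = step e (not d)

  src-flip : ∀ s → src (flip s) ≡ tgt s
  src-flip (step e true)  = refl
  src-flip (step e false) = refl

  tgt-flip : ∀ s → tgt (flip s) ≡ src s
  tgt-flip (step e true)  = refl
  tgt-flip (step e false) = refl

  revs : List Step → List Step
  revs []       = []
  revs (s ∷ ss) = revs ss ++ [ flip s ]

  chain-revs : ∀ {a b p} → Chain a p b → Chain b (revs p) a
  chain-revs (nil eq) = nil (sym eq)
  chain-revs (cons {s = s} eq c) =
    chain-++ (chain-revs c) (cons (src-flip s) (nil (trans (tgt-flip s) eq)))

  chainSign-revs : ∀ p → chainSign (revs p) ≡ chainSign p
  chainSign-revs []      = refl
  chainSign-revs (s ∷ p) = trans (chainSign-++ (revs p) [ flip s ])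
    (trans (cong₂ _·_ (chainSign-revs p) (·-identityʳ (sgn s))) (·-comm (chainSign p) (sgn s)))

  verts-revs : ∀ {a b p} → Chain a p b → verts (revs p) a ↭ verts p b
  verts-revs (nil refl) = ↭-refl
  verts-revs {b = b} (cons {s = s} {ss = ss} refl c) = ↭-trans
    (↭-reflexive (trans (verts-++ (revs ss) [ flip s ] (src s))
      (trans (cong (λ v → map src (revs ss) ++ v ∷ [ src s ]) (src-flip s))
             (sym (++-assoc (map src (revs ss)) [ tgt s ] [ src s ])))))
    (↭-trans (++⁺ʳ [ src s ] (verts-revs c)) (++-comm (verts ss b) [ src s ]))

  all-revs : ∀ {P : X → Set} {p} → All (P ∘ Step.edge) p → All (P ∘ Step.edge) (revs p)
  all-revs []         = []
  all-revs (ps ∷ pps) = Allₚ.++⁺ (all-revs pps) (ps ∷ [])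

  -- Elementary chains

  same-edge : ∀ s t → Step.edge s ≡ Step.edge t → src s ≡ src t ⊎ src s ≡ tgt t
  same-edge (step e true)  (step .e true)  refl = inj₁ refl
  same-edge (step e true)  (step .e false) refl = inj₂ refl
  same-edge (step e false) (step .e true)  refl = inj₂ refl
  same-edge (step e false) (step .e false) refl = inj₁ refl

  same-edge-tgt : ∀ s t → Step.edge s ≡ Step.edge t → tgt s ≡ src t ⊎ tgt s ≡ tgt t
  same-edge-tgt s t eq with same-edge (flip s) t eq
  ... | inj₁ q = inj₁ (trans (sym (src-flip s)) q)
  ... | inj₂ q = inj₂ (trans (sym (src-flip s)) q)

  ends∈ : ∀ {e t} (V : List (Fin n)) → e ≡ Step.edge t → src t ∈ V → tgt t ∈ V →
    ∀ s → e ≡ Step.edge s → src s ∈ V × tgt s ∈ V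
  ends∈ {t = t} V refl src∈ tgt∈ s eq with same-edge s t (sym eq) | same-edge-tgt s t (sym eq)
  ... | inj₁ p | inj₁ q = subst (_∈ V) (sym p) src∈ , subst (_∈ V) (sym q) src∈
  ... | inj₁ p | inj₂ q = subst (_∈ V) (sym p) src∈ , subst (_∈ V) (sym q) tgt∈
  ... | inj₂ p | inj₁ q = subst (_∈ V) (sym p) tgt∈ , subst (_∈ V) (sym q) src∈
  ... | inj₂ p | inj₂ q = subst (_∈ V) (sym p) tgt∈ , subst (_∈ V) (sym q) tgt∈

  chain-ends∈ : ∀ {a b p e} → Chain a p b → e ∈ map Step.edge p →
    ∀ s → e ≡ Step.edge s → src s ∈ verts p b × tgt s ∈ verts p b
  chain-ends∈ c e∈ with ∈-map⁻ Step.edge e∈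
  ... | t , t∈p , eq = ends∈ {t = t} _ eq (src∈verts t∈p) (tgt∈verts c t∈p)

  -- A second step along the same edge would visit the source of the first step again.
  unique-edges : ∀ {a b p} → Chain a p b → Unique (verts p b) → Unique (map Step.edge p)
  unique-edges (nil _) _ = []
  unique-edges (cons {s = s} eq c) u@(_ ∷ u′) =
    unique-∷⁺ (λ e∈ → unique-∷⁻ u (proj₁ (chain-ends∈ c e∈ s refl))) (unique-edges c u′)

  src≢tgt : ∀ {a b p t} → Chain a p b → Unique (verts p b) → t ∈ p → src t ≢ tgt t
  src≢tgt (cons _ c) u       (here refl) eq = unique-∷⁻ u (subst (_∈ _) (sym eq) (start∈verts c))
  src≢tgt (cons _ c) (_ ∷ u) (there t∈)  eq = src≢tgt c u t∈ eq

  -- Labellings along chains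

  module _ {k : ℕ} (h : Labelling n k) where

    SatStep : Step → Set
    SatStep s = Sat h (lab (Step.edge s))

    sat-step : ∀ s → SatStep s → h (src s) ≡ act (sgn s) (h (tgt s))
    sat-step (step e true)  p = p
    sat-step (step e false) p = act-flip (edgeSign (lab e)) p

    step-sat : ∀ s → h (src s) ≡ act (sgn s) (h (tgt s)) → SatStep s
    step-sat (step e true)  p = p
    step-sat (step e false) p = act-flip (edgeSign (lab e)) p

    -- Each satisfied edge determines the label at one end from the other up to its sign, and the
    -- signs multiply.
    sat-chain : ∀ {a b p} → Chain a p b → All SatStep p → h a ≡ act (chainSign p) (h b)
    sat-chain (nil refl) [] = sym (act-plus _)
    sat-chain (cons {s = s} refl c) (ps ∷ pps) =
      trans (sat-step s ps) (trans (cong (act (sgn s)) (sat-chain c pps)) (act-· (sgn s) _ _))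

    act-zero : ∀ {u v : Val k} s → u ≡ act s v → v ≡ nothing → u ≡ nothing
    act-zero s p refl = p

    zero-spreads : ∀ {a b p u v} → Chain a p b → All SatStep p →
      u ∈ verts p b → v ∈ verts p b → h u ≡ nothing → h v ≡ nothing
    zero-spreads {a} {b} {p} c sat u∈ v∈ hu = from v∈
      where
      start : ∀ {w} → w ∈ verts p b → ∃ λ s → h a ≡ act s (h w)
      start w∈ with splitAtVertex c w∈
      ... | split pre _ refl c₁ _ = _ , sat-chain c₁ (Allₚ.++⁻ˡ pre sat)
      from : ∀ {w} → w ∈ verts p b → h w ≡ nothing
      from w∈ with start u∈ | start w∈
      ... | s , p₁ | t , p₂ = act-zero t (act-flip t p₂) (act-zero s p₁ hu)

    -- One turn around the closed chain gives `h a` equal to its negative, and the zero then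
    -- spreads.
    negative-closed-zero : ∀ {a p v} → Chain a p a → All SatStep p → chainSign p ≡ minus →
      v ∈ verts p a → h v ≡ nothing
    negative-closed-zero {a} {p} c sat neg v∈ = zero-spreads c sat (end∈verts p) v∈
      (act-minus-fixed (h a) (subst (λ s → h a ≡ act s (h a)) neg (sat-chain c sat)))

    module _ {b : X} where

      Others : List X → Set
      Others es = ∀ {e} → e ∈ es → e ≡ b ⊎ Sat h (lab e)

      resolve : ∀ {e} → e ≡ b ⊎ Sat h (lab e) → e ≢ b → Sat h (lab e)
      resolve (inj₁ eq)  e≢b = ⊥-elim (e≢b eq)
      resolve (inj₂ sat) _   = sat

      others-sat : ∀ {p} → Others (map Step.edge p) → b ∉ map Step.edge p → All SatStep p
      others-sat o b∉ = All.tabulate λ t∈ → resolve (o (∈-map⁺ Step.edge t∈))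
        λ eq → b∉ (subst (_∈ _) eq (∈-map⁺ Step.edge t∈))

      record Cut (p : List Step) : Set where
        constructor cut
        field
          pre    : List Step
          at     : Step
          post   : List Step
          eq     : p ≡ pre ++ at ∷ post
          edge≡  : Step.edge at ≡ b
          sat-pre  : All SatStep pre
          sat-post : All SatStep post

      -- As `b` occurs only once, both sides of the cut consist of satisfied edges.
      cutAt : ∀ p → Unique (map Step.edge p) → Others (map Step.edge p) → b ∈ map Step.edge p → Cut p
      cutAt (s ∷ p) u o (here refl) = cut [] s p refl refl [] (others-sat (o ∘ there) (unique-∷⁻ u))
      cutAt (s ∷ p) u@(_ ∷ u′) o (there b∈) with cutAt p u′ (o ∘ there) b∈
      ... | cut pre t post refl e≡ sat₁ sat₂ = cut (s ∷ pre) t post refl e≡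
        (resolve (o (here refl)) (λ eq → unique-∷⁻ u (subst (_∈ _) (sym eq) b∈)) ∷ sat₁) sat₂

      zero-ends-sat : ∀ t → Step.edge t ≡ b → h (src t) ≡ nothing → h (tgt t) ≡ nothing → Sat h (lab b)
      zero-ends-sat t refl hs ht = step-sat t (trans hs (cong (act (sgn t)) (sym ht)))

      -- The way around that avoids `b` relates the ends of `b` by the sign of the remaining edges,
      -- which equals the sign of `b` because the total is `plus`.
      positive-closed-sat : ∀ {a p} → Chain a p a → Unique (map Step.edge p) → Others (map Step.edge p) →
        b ∈ map Step.edge p → chainSign p ≡ plus → Sat h (lab b)
      positive-closed-sat {a} {p} c u o b∈ pos with cutAt p u o b∈
      ... | cut pre t post refl refl sat₁ sat₂ with chain-++⁻ pre c
      ...   | _ , c₁ , cons refl c₂ = step-sat t (trans (act-flip σ (sat-chain c₁ sat₁))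
              (trans (cong (act σ) (act-flip τ (sat-chain c₂ sat₂)))
              (trans (act-· σ τ _) (cong (λ s → act s (h (tgt t)))
                (solve σ (sgn t) τ (trans (sym (chainSign-++ pre (t ∷ post))) pos))))))
        where
        σ τ : Sign
        σ = chainSign pre
        τ = chainSign post
        solve : ∀ s u t → s · (u · t) ≡ plus → s · t ≡ u
        solve plus  plus  plus  _ = refl
        solve plus  minus minus _ = refl
        solve minus plus  minus _ = refl
        solve minus minus plus  _ = refl

      -- The two pieces left after removing `b` still meet at `a`, so the zero at `v` reaches both
      -- ends of `b`.
      zero-closed-sat : ∀ {a p v} → Chain a p a → Unique (map Step.edge p) → Others (map Step.edge p) →
        b ∈ map Step.edge p → v ∈ map src p → h v ≡ nothing → Sat h (lab b)
      zero-closed-sat {a} {p} {v} c u o b∈ v∈ hv with cutAt p u o b∈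
      ... | cut pre t post refl e≡ sat₁ sat₂ with chain-++⁻ pre c
      ...   | _ , c₁ , cons refl c₂ = zero-ends-sat t e≡
                (zero-spreads c₁ sat₁ (start∈verts c₁) (end∈verts pre) ha)
                (zero-spreads c₂ sat₂ (end∈verts post) (start∈verts c₂) ha)
        where
        ha : h a ≡ nothing
        ha with ∈-++⁻ (map src pre) (subst (v ∈_) (map-++ src pre (t ∷ post)) v∈)
        ... | inj₁ v∈pre         = zero-spreads c₁ sat₁ (∈-++⁺ˡ v∈pre) (start∈verts c₁) hv
        ... | inj₂ (here refl)    = zero-spreads c₁ sat₁ (end∈verts pre) (start∈verts c₁) hv
        ... | inj₂ (there v∈post) = zero-spreads c₂ sat₂ (∈-++⁺ˡ v∈post) (end∈verts post) hv

      -- Removing `b` separates the chain, so each end of `b` receives its zero from a different end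
      -- of the chain.
      zero-chain-sat : ∀ {a c p} → Chain a p c → Unique (map Step.edge p) → Others (map Step.edge p) →
        b ∈ map Step.edge p → h a ≡ nothing → h c ≡ nothing → Sat h (lab b)
      zero-chain-sat {p = p} ch u o b∈ ha hc with cutAt p u o b∈
      ... | cut pre t post refl e≡ sat₁ sat₂ with chain-++⁻ pre ch
      ...   | _ , c₁ , cons refl c₂ = zero-ends-sat t e≡
                (zero-spreads c₁ sat₁ (start∈verts c₁) (end∈verts pre) ha)
                (zero-spreads c₂ sat₂ (end∈verts post) (start∈verts c₂) hc)

  -- Circuits as linear dependencies

  cycleSteps : Cycle → List Step
  cycleSteps C = Cycle.first C ∷ Cycle.rest C

  cycle-chain : ∀ C → Chain (src (Cycle.first C)) (cycleSteps C) (src (Cycle.first C))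
  cycle-chain C = subst (Chain _ _) (Cycle.closed C) (linked⇒chain (Cycle.linked C))

  cycle-ends∈ : ∀ C {e} → e ∈ cycleEdges C → ∀ s → e ≡ Step.edge s →
    src s ∈ cycleVerts C × tgt s ∈ cycleVerts C
  cycle-ends∈ C e∈ s eq with chain-ends∈ (cycle-chain C) e∈ s eq
  ... | p , q = to p , to q
    where
    to : ∀ {v} → v ∈ verts (cycleSteps C) (src (Cycle.first C)) → v ∈ cycleVerts C
    to v∈ with ∈-++⁻ (cycleVerts C) v∈
    ... | inj₁ v∈C         = v∈C
    ... | inj₂ (here refl) = here refl

  module _ (P : ElemChain) where
    open ElemChain P

    elem-chain : Chain (chainStart P) (first ∷ rest) (chainEnd P)
    elem-chain = linked⇒chain linked

    elem-unique-edges : Unique (chainEdges P)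
    elem-unique-edges = unique-edges elem-chain (subst Unique (verts-tgt elem-chain) elementary)

  module _ (C₁ C₂ : Cycle) (disj : ∀ w → w ∈ cycleVerts C₁ → w ∉ cycleVerts C₂) where

    disjoint-edges : ∀ {e} → e ∈ cycleEdges C₁ → e ∉ cycleEdges C₂
    disjoint-edges e∈₁ e∈₂ with ∈-map⁻ Step.edge {xs = cycleSteps C₁} e∈₁
    ... | t , _ , eq = disj _ (proj₁ (cycle-ends∈ C₁ e∈₁ t eq)) (proj₁ (cycle-ends∈ C₂ e∈₂ t eq))

    -- Every later step of `P` starts at an internal vertex, hence off both cycles. The first step
    -- starts on `C₁`, hence off `C₂`, and its target is internal or the end on `C₂`, hence off
    -- `C₁`.
    link-edges : (P : ElemChain) → chainStart P ∈ cycleVerts C₁ → chainEnd P ∈ cycleVerts C₂ →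
      All (λ w → w ∉ cycleVerts C₁ × w ∉ cycleVerts C₂) (chainInternal P) →
      ∀ {e} → e ∈ chainEdges P → e ∉ cycleEdges C₁ × e ∉ cycleEdges C₂
    link-edges P start end internal e∈P with ∈-map⁻ Step.edge {xs = ElemChain.first P ∷ ElemChain.rest P} e∈P
    ... | t , there t∈ , eq = (λ e∈ → proj₁ out (proj₁ (cycle-ends∈ C₁ e∈ t eq))) ,
                              (λ e∈ → proj₂ out (proj₁ (cycle-ends∈ C₂ e∈ t eq)))
      where out = All.lookup internal (∈-map⁺ src t∈)
    ... | t , here refl , eq = (λ e∈ → tgt∉ (elem-chain P) end internal (proj₂ (cycle-ends∈ C₁ e∈ t eq))) ,
                               (λ e∈ → disj _ start (proj₁ (cycle-ends∈ C₂ e∈ t eq)))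
      where
      tgt∉ : ∀ {a b s ss} → Chain a (s ∷ ss) b → b ∈ cycleVerts C₂ →
        All (λ w → w ∉ cycleVerts C₁ × w ∉ cycleVerts C₂) (map src ss) → tgt s ∉ cycleVerts C₁
      tgt∉ (cons _ (nil refl)) b∈ [] t∈ = disj _ t∈ b∈
      tgt∉ (cons _ (cons src≡ c)) b∈ (out ∷ _) t∈ = proj₁ out (subst (_∈ _) (sym src≡) t∈)

  -- In linear terms, each edge of a circuit lies in the span of the others.

  circuit-closed : ∀ c {k} (h : Labelling n k) {b} → b ∈ circuitEdges c →
    Others h {b} (circuitEdges c) → Sat h (lab b)
  circuit-closed (positiveCycle C pos) h b∈ o =
    positive-closed-sat h (cycle-chain C) (Cycle.edgesDistinct C) o b∈ pos
  circuit-closed (tightHandcuff C₁ C₂ neg₁ neg₂ disj (v , v∈₁ , v∈₂ , _)) h b∈ o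
    with ∈-++⁻ (cycleEdges C₁) b∈
  -- The cycle without `b` is fully satisfied and negative, so `h` vanishes at the common vertex.
  ... | inj₁ b∈₁ = zero-closed-sat h (cycle-chain C₁) (Cycle.edgesDistinct C₁) (o ∘ ∈-++⁺ˡ) b∈₁ v∈₁
        (negative-closed-zero h (cycle-chain C₂)
          (others-sat h (o ∘ ∈-++⁺ʳ (cycleEdges C₁)) (disj _ b∈₁)) neg₂ (∈-++⁺ˡ v∈₂))
  ... | inj₂ b∈₂ = zero-closed-sat h (cycle-chain C₂) (Cycle.edgesDistinct C₂)
        (o ∘ ∈-++⁺ʳ (cycleEdges C₁)) b∈₂ v∈₂
        (negative-closed-zero h (cycle-chain C₁)
          (others-sat h (o ∘ ∈-++⁺ˡ) (λ b∈₁ → disj _ b∈₁ b∈₂)) neg₁ (∈-++⁺ˡ v∈₁))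
  circuit-closed (looseHandcuff C₁ C₂ neg₁ neg₂ disj P start end internal) h {b} b∈ o =
    located (∈-++⁻ (cycleEdges C₁) b∈)
    where
    o₁ : Others h (cycleEdges C₁)
    o₁ = o ∘ ∈-++⁺ˡ
    o₂ : Others h (cycleEdges C₂)
    o₂ = o ∘ ∈-++⁺ʳ (cycleEdges C₁) ∘ ∈-++⁺ˡ
    oP : Others h (chainEdges P)
    oP = o ∘ ∈-++⁺ʳ (cycleEdges C₁) ∘ ∈-++⁺ʳ (cycleEdges C₂)
    link : ∀ {e} → e ∈ chainEdges P → e ∉ cycleEdges C₁ × e ∉ cycleEdges C₂
    link = link-edges C₁ C₂ disj P start end internal
    zero₁ : b ∉ cycleEdges C₁ → h (chainStart P) ≡ nothing
    zero₁ b∉ = negative-closed-zero h (cycle-chain C₁) (others-sat h o₁ b∉) neg₁ (∈-++⁺ˡ start)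
    zero₂ : b ∉ cycleEdges C₂ → h (chainEnd P) ≡ nothing
    zero₂ b∉ = negative-closed-zero h (cycle-chain C₂) (others-sat h o₂ b∉) neg₂ (∈-++⁺ˡ end)
    start∈ = start∈verts (elem-chain P)
    end∈ = end∈verts (ElemChain.first P ∷ ElemChain.rest P)
    located : b ∈ cycleEdges C₁ ⊎ b ∈ cycleEdges C₂ ++ chainEdges P → Sat h (lab b)
    -- The zero comes from the other cycle and travels along the whole chain.
    located (inj₁ b∈₁) = zero-closed-sat h (cycle-chain C₁) (Cycle.edgesDistinct C₁) o₁ b∈₁ start
      (zero-spreads h (elem-chain P) (others-sat h oP (λ b∈P → proj₁ (link b∈P) b∈₁)) end∈ start∈
        (zero₂ (disjoint-edges C₁ C₂ disj b∈₁)))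
    located (inj₂ b∈₂P) with ∈-++⁻ (cycleEdges C₂) b∈₂P
    ... | inj₁ b∈₂ = zero-closed-sat h (cycle-chain C₂) (Cycle.edgesDistinct C₂) o₂ b∈₂ end
      (zero-spreads h (elem-chain P) (others-sat h oP (λ b∈P → proj₂ (link b∈P) b∈₂)) start∈ end∈
        (zero₁ (λ b∈₁ → disjoint-edges C₁ C₂ disj b∈₁ b∈₂)))
    -- Both cycles avoid `b` and supply a zero at each end of the chain.
    ... | inj₂ b∈P = zero-chain-sat h (elem-chain P) (elem-unique-edges P) oP b∈P
      (zero₁ (proj₁ (link b∈P))) (zero₂ (proj₂ (link b∈P)))

  CircuitFree : (X → Set) → Set
  CircuitFree S = ¬ Σ CircuitWitness (λ c → All S (circuitEdges c))

  -- Linear independence: each edge lies outside the span of the later ones.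

  data Staircase : List X → Set where
    []  : Staircase []
    _∷_ : ∀ {b B} → (∃ λ k → Σ (Labelling n k) λ h → All (Sat h ∘ lab) B × ¬ Sat h (lab b)) →
          Staircase B → Staircase (b ∷ B)

  staircase-unique : ∀ {B} → Staircase B → Unique B
  staircase-unique [] = []
  staircase-unique ((k , h , sat , unsat) ∷ st) =
    unique-∷⁺ (λ b∈B → unsat (All.lookup sat b∈B)) (staircase-unique st)

  -- A circuit through the top edge would force the labelling that separates this edge from the
  -- later ones to kill it too. Any other circuit lies in the tail.
  staircase-circuit-free : ∀ {B} → Staircase B → CircuitFree (_∈ B)
  staircase-circuit-free [] (positiveCycle _ _ , () ∷ _)
  staircase-circuit-free [] (tightHandcuff _ _ _ _ _ _ , () ∷ _)
  staircase-circuit-free [] (looseHandcuff _ _ _ _ _ _ _ _ _ , () ∷ _)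
  staircase-circuit-free {b ∷ B} ((k , h , sat , unsat) ∷ st) (c , c⊆) with topOrBelow c⊆
    where
    topOrBelow : ∀ {es} → All (_∈ b ∷ B) es → b ∈ es ⊎ All (_∈ B) es
    topOrBelow [] = inj₂ []
    topOrBelow (here refl ∷ _) = inj₁ (here refl)
    topOrBelow (there e∈ ∷ rest) with topOrBelow rest
    ... | inj₁ b∈  = inj₁ (there b∈)
    ... | inj₂ all = inj₂ (e∈ ∷ all)
  ... | inj₂ below = staircase-circuit-free st (c , below)
  ... | inj₁ b∈c   = unsat (circuit-closed c h b∈c (λ e∈ → other (All.lookup c⊆ e∈)))
    where
    other : ∀ {e} → e ∈ b ∷ B → e ≡ b ⊎ Sat h (lab e)
    other (here eq)  = inj₁ eq
    other (there e∈) = inj₂ (All.lookup sat e∈)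

  unique-prefix : ∀ p {q v b} → Chain v q b → Unique (verts (p ++ q) b) → Unique (verts p v)
  unique-prefix p {q} {v} {b} c u = proj₁ (unique-++⁻ (verts p v) (subst Unique
    (trans (verts-++ p q b) (trans (cong (map src p ++_) (sym (verts-tgt c)))
      (sym (++-assoc (map src p) [ v ] (map tgt q))))) u))

  -- Two cycles in one component

  record Fundamental (F : X → Set) (s : Step) : Set where
    field
      path   : List Step
      chain  : Chain (tgt s) path (src s)
      unique : Unique (verts path (src s))
      inF    : All (F ∘ Step.edge) path

    vs : List (Fin n)
    vs = verts path (src s)

    -- The path lies in `F`, so the closing edge outside `F` cannot recur on it.
    cycle : ¬ F (Step.edge s) → Cycle
    cycle s∉F = record
      { first = s
      ; rest = path
      ; linked = proj₁ (chain⇒linked (cons refl chain))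
      ; closed = proj₂ (chain⇒linked (cons refl chain))
      ; edgesDistinct = unique-∷⁺ (λ e∈ → s∉F (All.lookup (Allₚ.map⁺ inF) e∈)) (unique-edges chain unique)
      ; vertsDistinct = unique-resp-↭ (++-comm (map src path) [ src s ]) unique
      }

    src∈ : ∀ {v} → v ∈ src s ∷ map src path → v ∈ vs
    src∈ = ∈-resp-↭ (++-comm [ src s ] (map src path))

    ∈src : ∀ {v} → v ∈ vs → v ∈ src s ∷ map src path
    ∈src = ∈-resp-↭ (++-comm (map src path) [ src s ])

  -- Arcs of a cycle

  module _ {s : Step} {T : List Step} (c : Chain (tgt s) T (src s)) (u : Unique (verts T (src s))) where

    record Arc (z w : Fin n) : Set where
      constructor arc
      field
        steps  : List Step
        chain  : Chain z steps w
        unique : Unique (verts steps w)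
        within : All (_∈ verts T (src s)) (verts steps w)
        edges  : All ((_∈ map Step.edge (s ∷ T)) ∘ Step.edge) steps

    reverseArc : ∀ {z w} → Arc z w → Arc w z
    reverseArc (arc A cA uA inA eA) = arc (revs A) (chain-revs cA)
      (unique-resp-↭ (↭-sym (verts-revs cA)) uA)
      (All.tabulate (λ v∈ → All.lookup inA (∈-resp-↭ (verts-revs cA) v∈)))
      (all-revs eA)

    -- The second arc leads back from `w` to `z`, so that together they go once around the cycle.
    ComplementaryArcs : Fin n → Fin n → Set
    ComplementaryArcs z w = Σ (Arc z w) λ A → Σ (Arc w z) λ A′ →
      chainSign (Arc.steps A) · chainSign (Arc.steps A′) ≡ chainSign (s ∷ T)

    private
      -- With `z` before `w` on the path, one arc is the stretch between them. The other continues
      -- from `w`, crosses `s` and reaches `z` from the beginning of the path.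
      ordered : ∀ {z w} T₁ T₂ T₃ → T ≡ T₁ ++ T₂ ++ T₃ → z ≢ w →
        Chain (tgt s) T₁ z → Chain z T₂ w → Chain w T₃ (src s) → ComplementaryArcs z w
      ordered T₁ [] T₃ _ z≢w _ (nil z≡w) _ = ⊥-elim (z≢w z≡w)
      ordered {z} {w} T₁ T₂@(t ∷ T₂′) T₃ refl z≢w c₁ c₂@(cons refl _) c₃ =
        arc T₂ c₂
          (proj₁ (unique-++⁻ (verts T₂ w) (proj₁ (proj₂ (unique-++⁻ (map src T₁) (subst Unique split₁ u))))))
          (All.tabulate λ v∈ → subst (_ ∈_) (sym split₁) (∈-++⁺ʳ (map src T₁) (∈-++⁺ˡ v∈)))
          (All.tabulate λ t∈ → there (∈-map⁺ Step.edge (∈-++⁺ʳ T₁ (∈-++⁺ˡ t∈)))) ,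
        arc (T₃ ++ s ∷ T₁) (chain-++ c₃ (cons refl c₁))
          (proj₁ (proj₂ (unique-++⁻ (map src T₂′) (unique-resp-↭ split₂ u))))
          (All.tabulate λ v∈ → ∈-resp-↭ (↭-sym split₂) (∈-++⁺ʳ (map src T₂′) v∈))
          (Allₚ.++⁺ (All.tabulate λ t∈ → there (∈-map⁺ Step.edge (∈-++⁺ʳ T₁ (∈-++⁺ʳ T₂ t∈))))
            (here refl ∷ All.tabulate λ t∈ → there (∈-map⁺ Step.edge (∈-++⁺ˡ t∈)))) ,
        signs
        where
        split₁ : verts (T₁ ++ T₂ ++ T₃) (src s) ≡ map src T₁ ++ verts T₂ w ++ map tgt T₃
        split₁ = trans (verts-++ T₁ (T₂ ++ T₃) (src s)) (cong (map src T₁ ++_)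
          (trans (verts-++ T₂ T₃ (src s)) (trans (cong (map src T₂ ++_) (sym (verts-tgt c₃)))
            (sym (++-assoc (map src T₂) [ w ] (map tgt T₃))))))
        -- A rotation of the vertex list in which `z`, the first vertex of `T₂`, becomes the end of
        -- the second arc.
        split₂ : verts (T₁ ++ T₂ ++ T₃) (src s) ↭ map src T₂′ ++ verts (T₃ ++ s ∷ T₁) z
        split₂ = ↭-trans
          (↭-reflexive (trans (verts-++ T₁ (T₂ ++ T₃) (src s))
            (trans (cong (map src T₁ ++_) (verts-++ T₂ T₃ (src s)))
              (sym (++-assoc (map src T₁) [ z ] (map src T₂′ ++ verts T₃ (src s)))))))
          (↭-trans (++-comm (verts T₁ z) (map src T₂′ ++ verts T₃ (src s)))
            (↭-reflexive (trans (++-assoc (map src T₂′) (verts T₃ (src s)) (verts T₁ z))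
              (cong (map src T₂′ ++_) (trans (++-assoc (map src T₃) [ src s ] (verts T₁ z))
                (sym (verts-++ T₃ (s ∷ T₁) z)))))))
        signs : chainSign T₂ · chainSign (T₃ ++ s ∷ T₁) ≡ chainSign (s ∷ T₁ ++ T₂ ++ T₃)
        signs = trans (cong (chainSign T₂ ·_) (chainSign-++ T₃ (s ∷ T₁)))
          (trans (sym (·-assoc (chainSign T₂) (chainSign T₃) _))
          (trans (cong (_· chainSign (s ∷ T₁)) (sym (chainSign-++ T₂ T₃)))
          (trans (·-comm (chainSign (T₂ ++ T₃)) _) (sym (chainSign-++ (s ∷ T₁) (T₂ ++ T₃))))))

    complementaryArcs : ∀ {z w} → z ∈ verts T (src s) → w ∈ verts T (src s) → z ≢ w → ComplementaryArcs z w
    complementaryArcs {z} {w} z∈ w∈ z≢w with splitAtVertex c z∈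
    ... | split p q refl cp cq with ∈-++⁻ (map src p) (subst (w ∈_) (verts-++ p q (src s)) w∈)
    ...   | inj₂ w∈q with splitAtVertex cq w∈q
    ...     | split q₁ q₂ refl d₁ d₂ = ordered p q₁ q₂ refl z≢w cp d₁ d₂
    complementaryArcs {z} {w} z∈ w∈ z≢w | split p q refl cp cq | inj₁ w∈p with splitAtVertex cp (∈-++⁺ˡ w∈p)
    ...     | split p₁ p₂ refl d₁ d₂ with ordered p₁ p₂ q (++-assoc p₁ p₂ q) (z≢w ∘ sym) d₁ d₂ cq
    ...       | A , A′ , eq = A′ , A , trans (·-comm (chainSign (Arc.steps A′)) _) eq

    -- The two arcs of a negative cycle have opposite signs, and reversing an arc keeps its sign.
    arcOfSign : ∀ {z w} → z ∈ verts T (src s) → w ∈ verts T (src s) → z ≢ w → chainSign (s ∷ T) ≡ minus →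
      ∀ σ → Σ (Arc z w) λ A → chainSign (Arc.steps A) ≡ σ
    arcOfSign z∈ w∈ z≢w neg σ with complementaryArcs z∈ w∈ z≢w
    ... | A , A′ , eq with ·-opposite _ _ (trans eq neg) σ
    ...   | inj₁ A≡σ  = A , A≡σ
    ...   | inj₂ A′≡σ = reverseArc A′ , trans (chainSign-revs (Arc.steps A′)) A′≡σ

  -- Fundamental cycles in a circuit-free set

  module _ {S F : X → Set} (F⊆S : ∀ {e} → F e → S e) (free : CircuitFree S) where

    negative-fundamental : ∀ {s} → S (Step.edge s) → ¬ F (Step.edge s) → (C : Fundamental F s) →
      chainSign (s ∷ Fundamental.path C) ≡ minus
    negative-fundamental {s} s∈S s∉F C with chainSign (s ∷ Fundamental.path C) in eq
    ... | minus = refl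
    ... | plus  = ⊥-elim (free (positiveCycle (Fundamental.cycle C s∉F) eq ,
                    s∈S ∷ Allₚ.map⁺ (All.map F⊆S (Fundamental.inF C))))

    module _ {s s′ : Step} (s∈S : S (Step.edge s)) (s′∈S : S (Step.edge s′))
             (s∉F : ¬ F (Step.edge s)) (s′∉F : ¬ F (Step.edge s′)) (s≢s′ : Step.edge s ≢ Step.edge s′)
             (D : Fundamental F s) (D′ : Fundamental F s′) where

      open Fundamental D using () renaming (path to T; chain to c; unique to u; inF to T⊆F; vs to V)
      open Fundamental D′ using () renaming (path to T′; chain to c′; unique to u′; inF to T′⊆F; vs to V′)

      private
        C C′ : Cycle
        C  = Fundamental.cycle D s∉F
        C′ = Fundamental.cycle D′ s′∉F

        negC : chainSign (s ∷ T) ≡ minus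
        negC = negative-fundamental s∈S s∉F D

        negC′ : chainSign (s′ ∷ T′) ≡ minus
        negC′ = negative-fundamental s′∈S s′∉F D′

        C⊆S : All S (cycleEdges C)
        C⊆S = s∈S ∷ Allₚ.map⁺ (All.map F⊆S T⊆F)

        C′⊆S : All S (cycleEdges C′)
        C′⊆S = s′∈S ∷ Allₚ.map⁺ (All.map F⊆S T′⊆F)

      -- After loop erasure, `W` is cut at its first vertex on `V` and then at the last earlier
      -- vertex on `V′`. The piece between is internally disjoint from both cycles and completes a
      -- loose handcuff.
      not-disjoint : ∀ {W} → Chain (tgt s′) W (tgt s) → All (F ∘ Step.edge) W → ¬ All (_∉ V) V′
      not-disjoint cW W⊆F disjoint with loopErase cW
      ... | p , cp , up , p⊆W with firstHit V cp
      ...   | inj₁ avoids = All.lookup avoids (end∈verts p) (start∈verts c)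
      ...   | inj₂ (v , split p₁ p₂ refl cp₁ cp₂ , v∈V , out) with lastHit V′ cp₁
      ...     | inj₁ avoids = All.lookup avoids (start∈verts cp₁) (start∈verts c′)
      -- An empty piece would place one vertex on both cycles.
      ...     | inj₂ (w , split q₁ [] refl _ (nil refl) , w∈V′ , _) = All.lookup disjoint w∈V′ v∈V
      ...     | inj₂ (w , split q₁ (t ∷ q₂) refl cq₁ cq@(cons refl cq₂) , w∈V′ , out′) =
        free (looseHandcuff C′ C negC′ negC
                (λ x x∈C′ x∈C → All.lookup disjoint (Fundamental.src∈ D′ x∈C′) (Fundamental.src∈ D x∈C))
                P (Fundamental.∈src D′ w∈V′) (Fundamental.∈src D end∈V) internal ,
              Allₚ.++⁺ C′⊆S (Allₚ.++⁺ C⊆S (Allₚ.map⁺ (All.tabulate λ x∈ →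
                F⊆S (All.lookup W⊆F (p⊆W (∈-++⁺ˡ (∈-++⁺ʳ q₁ x∈))))))))
        where
        uq : Unique (verts (t ∷ q₂) v)
        uq = proj₁ (proj₂ (unique-++⁻ (map src q₁) (subst Unique (verts-++ q₁ (t ∷ q₂) v)
          (unique-prefix (q₁ ++ t ∷ q₂) cp₂ up))))
        P : ElemChain
        P = record
          { first = t ; rest = q₂ ; linked = proj₁ (chain⇒linked cq)
          ; elementary = subst Unique (sym (verts-tgt cq)) uq }
        end∈V : tgt (lastOf t q₂) ∈ V
        end∈V = subst (_∈ V) (sym (proj₂ (chain⇒linked cq))) v∈V
        internal : All (λ x → x ∉ cycleVerts C′ × x ∉ cycleVerts C) (map src q₂)
        internal = All.tabulate λ {x} x∈ →
          (λ x∈C′ → All.lookup out′ (subst (x ∈_) (sym (verts-tgt cq₂)) (∈-++⁺ˡ x∈)) (Fundamental.src∈ D′ x∈C′)) ,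
          (λ x∈C → All.lookup out (subst (x ∈_) (sym (map-++ src q₁ (t ∷ q₂))) (∈-++⁺ʳ (map src q₁) (there x∈)))
            (Fundamental.src∈ D x∈C))

      -- The cycles meet only at `z` and would form a tight handcuff.
      not-tangent : ∀ {z} T₁ T₃ → T′ ≡ T₁ ++ T₃ → z ∈ V → Chain (tgt s′) T₁ z → Chain z T₃ (src s′) →
        All (_∉ V) (map src T₁) → All (_∉ V) (map tgt T₃) → ⊥
      not-tangent {z} T₁ T₃ T′≡ z∈V c₁ c₃ out₁ out₃ =
        free (tightHandcuff C C′ negC negC′ (λ _ → edges-disjoint)
                (z , Fundamental.∈src D z∈V , Fundamental.∈src D′ z∈V′ ,
                  λ x x∈C x∈C′ → only (Fundamental.src∈ D x∈C) (Fundamental.src∈ D′ x∈C′)) ,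
              Allₚ.++⁺ C⊆S C′⊆S)
        where
        V′≡ : V′ ≡ map src T₁ ++ z ∷ map tgt T₃
        V′≡ = trans (cong (λ p → verts p (src s′)) T′≡)
          (trans (verts-++ T₁ T₃ (src s′)) (cong (map src T₁ ++_) (sym (verts-tgt c₃))))
        z∈V′ : z ∈ V′
        z∈V′ = subst (z ∈_) (sym V′≡) (∈-++⁺ʳ (map src T₁) (here refl))
        only : ∀ {x} → x ∈ V → x ∈ V′ → x ≡ z
        only {x} x∈V x∈V′ with ∈-++⁻ (map src T₁) (subst (x ∈_) V′≡ x∈V′)
        ... | inj₁ x∈₁         = ⊥-elim (All.lookup out₁ x∈₁ x∈V)
        ... | inj₂ (here eq)   = eq
        ... | inj₂ (there x∈₃) = ⊥-elim (All.lookup out₃ x∈₃ x∈V)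
        edges-disjoint : ∀ {e} → e ∈ cycleEdges C → e ∉ cycleEdges C′
        edges-disjoint (here refl) (here eq)   = s≢s′ eq
        edges-disjoint (here refl) (there e∈′) = s∉F (All.lookup (Allₚ.map⁺ T′⊆F) e∈′)
        edges-disjoint (there e∈)  (here refl) = s′∉F (All.lookup (Allₚ.map⁺ T⊆F) e∈)
        -- An edge on both paths would have both its ends at `z`, but an elementary chain contains
        -- no loop.
        edges-disjoint (there e∈)  (there e∈′) with ∈-map⁻ Step.edge e∈
        ... | t , t∈ , eq with chain-ends∈ c′ e∈′ t eq
        ...   | src∈ , tgt∈ = src≢tgt c u t∈
                (trans (only (src∈verts t∈) src∈) (sym (only (tgt∈verts c t∈) tgt∈)))

      -- Replacing `M` by an arc of the first cycle gives again a cycle, since `T₁` and `T₃` meet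
      -- `V` only at `z` and `w`. A suitable choice between the two arcs makes it positive.
      not-theta : ∀ {z w} T₁ M T₃ → T′ ≡ T₁ ++ M ++ T₃ → z ∈ V → w ∈ V → z ≢ w →
        Chain (tgt s′) T₁ z → Chain w T₃ (src s′) →
        All (_∉ V) (map src T₁) → All (_∉ V) (map tgt T₃) → ⊥
      not-theta {z} {w} T₁ M T₃ T′≡ z∈V w∈V z≢w c₁ c₃ out₁ out₃
        -- The sign of the rest of the new cycle, so that the total product is a square.
        with arcOfSign {s = s} c u z∈V w∈V z≢w negC (sgn s′ · (chainSign T₁ · chainSign T₃))
      ... | arc A cA uA inA eA , A≡σ = free (positiveCycle N pos , edges)
        where
        path = T₁ ++ A ++ T₃
        u₁₃ : Unique (map src T₁ ++ (map src M ++ verts T₃ (src s′)))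
        u₁₃ = subst Unique (trans (cong (λ p → verts p (src s′)) T′≡)
          (trans (verts-++ T₁ (M ++ T₃) (src s′)) (cong (map src T₁ ++_) (verts-++ M T₃ (src s′))))) u′
        A#T₃ : Disjoint (map src A) (verts T₃ (src s′))
        A#T₃ (x∈A , x∈₃) with subst (_ ∈_) (sym (verts-tgt c₃)) x∈₃
        ... | here refl = proj₂ (proj₂ (unique-++⁻ (map src A) uA)) (x∈A , here refl)
        ... | there x∈  = All.lookup out₃ x∈ (All.lookup inA (∈-++⁺ˡ x∈A))
        T₁#rest : Disjoint (map src T₁) (map src A ++ verts T₃ (src s′))
        T₁#rest (x∈₁ , x∈) with ∈-++⁻ (map src A) x∈
        ... | inj₁ x∈A = All.lookup out₁ x∈₁ (All.lookup inA (∈-++⁺ˡ x∈A))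
        ... | inj₂ x∈₃ = proj₂ (proj₂ (unique-++⁻ (map src T₁) u₁₃)) (x∈₁ , ∈-++⁺ʳ (map src M) x∈₃)
        uN : Unique (verts path (src s′))
        uN = subst Unique (sym (trans (verts-++ T₁ (A ++ T₃) (src s′)) (cong (map src T₁ ++_) (verts-++ A T₃ (src s′)))))
          (Uniqueₚ.++⁺ (proj₁ (unique-++⁻ (map src T₁) u₁₃))
            (Uniqueₚ.++⁺ (proj₁ (unique-++⁻ (map src A) uA))
              (proj₁ (proj₂ (unique-++⁻ (map src M) (proj₁ (proj₂ (unique-++⁻ (map src T₁) u₁₃)))))) A#T₃)
            T₁#rest)
        T₁₃⊆F : All (F ∘ Step.edge) (T₁ ++ M ++ T₃)
        T₁₃⊆F = subst (All (F ∘ Step.edge)) T′≡ T′⊆F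
        fundamental : Fundamental (λ e → F e ⊎ e ≡ Step.edge s) s′
        fundamental = record
          { path = path ; chain = chain-++ c₁ (chain-++ cA c₃) ; unique = uN
          ; inF = Allₚ.++⁺ (All.map inj₁ (Allₚ.++⁻ˡ T₁ T₁₃⊆F))
              (Allₚ.++⁺ (All.map (λ { (here eq) → inj₂ eq ; (there e∈) → inj₁ (All.lookup (Allₚ.map⁺ T⊆F) e∈) }) eA)
                (All.map inj₁ (Allₚ.++⁻ʳ M (Allₚ.++⁻ʳ T₁ T₁₃⊆F)))) }
        N : Cycle
        N = Fundamental.cycle fundamental λ { (inj₁ s′∈F) → s′∉F s′∈F ; (inj₂ eq) → s≢s′ (sym eq) }
        pos : sgn s′ · chainSign path ≡ plus
        pos = trans (cong (sgn s′ ·_) (trans (chainSign-++ T₁ (A ++ T₃)) (cong (chainSign T₁ ·_)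
                (trans (chainSign-++ A T₃) (cong (_· chainSign T₃) A≡σ)))))
              (cancel (sgn s′) (chainSign T₁) (chainSign T₃))
          where
          cancel : ∀ a b d → a · (b · ((a · (b · d)) · d)) ≡ plus
          cancel plus  plus  d = ·-self d
          cancel plus  minus plus  = refl
          cancel plus  minus minus = refl
          cancel minus plus  plus  = refl
          cancel minus plus  minus = refl
          cancel minus minus plus  = refl
          cancel minus minus minus = refl
        edges : All S (cycleEdges N)
        edges = s′∈S ∷ Allₚ.map⁺ (All.map (λ { (inj₁ e∈F) → F⊆S e∈F ; (inj₂ eq) → subst S (sym eq) s∈S })
          (Fundamental.inF fundamental))

      -- The cases are whether the second cycle meets the first in no vertex, in one, or in at least
      -- two. Each produces a circuit of a different kind.
      no-two-cycles : ∀ {W} → Chain (tgt s′) W (tgt s) → All (F ∘ Step.edge) W → ⊥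
      no-two-cycles cW W⊆F with firstHit V c′
      ... | inj₁ avoids = not-disjoint cW W⊆F avoids
      ... | inj₂ (z , split T₁ R T′≡ c₁ cR , z∈V , out₁) with lastHit V cR
      ...   | inj₁ avoids = All.lookup avoids (start∈verts cR) z∈V
      ...   | inj₂ (w , split [] T₃ refl (nil refl) c₃ , w∈V , out₃) = not-tangent T₁ T₃ T′≡ z∈V c₁ c₃ out₁ out₃
      ...   | inj₂ (w , split M@(t ∷ M′) T₃ refl cM@(cons refl _) c₃ , w∈V , out₃) =
        not-theta T₁ M T₃ T′≡ z∈V w∈V z≢w c₁ c₃ out₁ out₃
        where
        -- `M` is nonempty and lies on an elementary chain, so its two ends differ.
        z≢w : src t ≢ w
        z≢w eq = unique-∷⁻ uR (subst (λ x → x ∈ map src (M′ ++ T₃) ++ [ src s′ ]) (sym eq)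
                   (subst (w ∈_) (sym (verts-++ M′ T₃ (src s′))) (∈-++⁺ʳ (map src M′) (start∈verts c₃))))
          where
          uR : Unique (verts (M ++ T₃) (src s′))
          uR = proj₁ (proj₂ (unique-++⁻ (map src T₁)
            (subst Unique (trans (cong (λ p → verts p (src s′)) T′≡) (verts-++ T₁ (M ++ T₃) (src s′))) u′)))

  -- Spanning forests

  Walk : (X → Set) → Fin n → Fin n → Set
  Walk S a b = ∃ λ p → Chain a p b × All (S ∘ Step.edge) p

  walk-refl : ∀ {S a b} → a ≡ b → Walk S a b
  walk-refl eq = [] , nil eq , []

  walk-sym : ∀ {S a b} → Walk S a b → Walk S b a
  walk-sym (p , c , inS) = revs p , chain-revs c , all-revs inS

  walk-trans : ∀ {S a b c} → Walk S a b → Walk S b c → Walk S a c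
  walk-trans (p , c , inS) (q , d , inS′) = p ++ q , chain-++ c d , Allₚ.++⁺ inS inS′

  walk-map : ∀ {S S′ a b} → (∀ {e} → S e → S′ e) → Walk S a b → Walk S′ a b
  walk-map f (p , c , inS) = p , c , All.map f inS

  -- `F` holds the forest edges, `E` the remaining edges of `I`, and `class` numbers the trees.
  -- Acyclicity of `F` is expressed by the count `rank`.
  record Forest (I : List X) (k : ℕ) : Set where
    field
      F E       : List X
      class     : Fin n → Fin k
      rep       : Fin k → Fin n
      rank      : length F + k ≡ n
      total     : length F + length E ≡ length I
      F⊆I       : ∀ {e} → e ∈ F → e ∈ I
      E⊆I       : ∀ {e} → e ∈ E → e ∈ I
      E-unique  : Unique E
      E#F       : ∀ {e} → e ∈ E → e ∉ F
      E-class   : ∀ {e} → e ∈ E → class (Edge.x (lab e)) ≡ class (Edge.y (lab e))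
      walkToRep : ∀ v → Walk (_∈ F) v (rep (class v))

    walk : ∀ {u v} → class u ≡ class v → Walk (_∈ F) u v
    walk {u} {v} eq = walk-trans (walkToRep u)
      (walk-trans (walk-refl (cong rep eq)) (walk-sym (walkToRep v)))

  module _ {e : X} {I : List X} (e∉I : e ∉ I) where
    open Edge (lab e)

    joinForest : ∀ {k} (Φ : Forest I (suc k)) → Forest.class Φ x ≢ Forest.class Φ y → Forest (e ∷ I) k
    joinForest {k} Φ r≢y = record
      { F = e ∷ F ; E = E
      ; class = merge ∘ class
      ; rep = rep ∘ punchIn r
      ; rank = trans (sym (+-suc (length F) k)) rank
      ; total = cong suc total
      ; F⊆I = λ { (here eq) → here eq ; (there f∈) → there (F⊆I f∈) }
      ; E⊆I = there ∘ E⊆I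
      ; E-unique = E-unique
      ; E#F = λ { f∈E (here refl) → e∉I (E⊆I f∈E) ; f∈E (there f∈F) → E#F f∈E f∈F }
      ; E-class = cong merge ∘ E-class
      ; walkToRep = toRep
      }
      where
      open Forest Φ
      r : Fin (suc k)
      r = class x
      -- The tree of `x` is absorbed by the tree of `y`, and the number `r` is freed.
      merge : Fin (suc k) → Fin k
      merge i with r ≟ i
      ... | yes _   = punchOut r≢y
      ... | no r≢i = punchOut r≢i
      old : ∀ {u v} → Walk (_∈ F) u v → Walk (_∈ e ∷ F) u v
      old = walk-map there
      toRep : ∀ v → Walk (_∈ e ∷ F) v (rep (punchIn r (merge (class v))))
      toRep v with r ≟ class v
      ... | no r≢i  = walk-trans (old (walkToRep v)) (walk-refl (cong rep (sym (punchIn-punchOut r≢i))))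
      -- A vertex of the absorbed tree walks to `x`, crosses `e` and continues from `y`.
      ... | yes r≡i = walk-trans (old (walk (sym r≡i)))
              (walk-trans (step e true ∷ [] , cons refl (nil refl) , here refl ∷ [])
              (walk-trans (old (walkToRep y)) (walk-refl (cong rep (sym (punchIn-punchOut r≢y))))))

    closeCycle : ∀ {k} (Φ : Forest I k) → Forest.class Φ x ≡ Forest.class Φ y → Forest (e ∷ I) k
    closeCycle Φ x≡y = record
      { F = F ; E = e ∷ E ; class = class ; rep = rep ; rank = rank
      ; total = trans (+-suc (length F) (length E)) (cong suc total)
      ; F⊆I = there ∘ F⊆I
      ; E⊆I = λ { (here eq) → here eq ; (there f∈) → there (E⊆I f∈) }
      ; E-unique = unique-∷⁺ (e∉I ∘ E⊆I) E-unique
      ; E#F = λ { (here refl) f∈F → e∉I (F⊆I f∈F) ; (there f∈E) f∈F → E#F f∈E f∈F }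
      ; E-class = λ { (here refl) → x≡y ; (there f∈) → E-class f∈ }
      ; walkToRep = walkToRep
      }
      where open Forest Φ

    addToForest : ∀ {k} → Forest I k → ∃ (Forest (e ∷ I))
    addToForest {zero} Φ with () ← Forest.class Φ x
    addToForest {suc k} Φ with Forest.class Φ x ≟ Forest.class Φ y
    ... | yes x≡y = suc k , closeCycle Φ x≡y
    ... | no x≢y  = k , joinForest Φ x≢y

  spanningForest : ∀ {I} → Unique I → ∃ (Forest I)
  spanningForest [] = n , record
    { F = [] ; E = [] ; class = id ; rep = id ; rank = refl ; total = refl
    ; F⊆I = λ () ; E⊆I = λ () ; E-unique = [] ; E#F = λ () ; E-class = λ ()
    ; walkToRep = λ _ → walk-refl refl }
  spanningForest u@(_ ∷ u′) = addToForest (unique-∷⁻ u) (proj₂ (spanningForest u′))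

  -- Every tree of the forest carries at most one further edge and, if it carries one, no
  -- representative of a label, because the labelling vanishes on it.

  circuit-free-bound : ∀ {I k} (L : Labels n k) → Unique I → CircuitFree (_∈ I) →
    All (Sat (Labels.lbl L) ∘ lab) I → length I + k ≤ n
  circuit-free-bound {I} {k} L u free sat = begin
    length I + k              ≡⟨ cong (_+ k) (sym total) ⟩
    length F + length E + k   ≡⟨ +-assoc (length F) (length E) k ⟩
    length F + (length E + k) ≡⟨ cong (length F +_) (+-comm (length E) k) ⟩
    length F + (k + length E) ≤⟨ +-monoʳ-≤ (length F) (injective⇒≤ place-injective) ⟩
    length F + k′             ≡⟨ rank ⟩
    n                         ∎
    where
    open ≤-Reasoning
    open Labels L renaming (rep to labelRep)
    k′ = proj₁ (spanningForest u)
    Φ = proj₂ (spanningForest u)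
    open Forest Φ

    F-sat : ∀ {p} → All ((_∈ F) ∘ Step.edge) p → All (SatStep lbl) p
    F-sat = All.map (All.lookup sat ∘ F⊆I)

    fundamental : ∀ {e} → e ∈ E → Fundamental (_∈ F) (step e true)
    fundamental e∈ with walk (sym (E-class e∈))
    ... | p , c , p⊆F with loopErase c
    ...   | q , d , uq , q⊆p = record
            { path = q ; chain = d ; unique = uq ; inF = All.tabulate (All.lookup p⊆F ∘ q⊆p) }

    -- The fundamental cycle of `e` is negative, as a positive one would be a circuit in `I`.
    zero-on-E : ∀ {e} → e ∈ E → lbl (Edge.x (lab e)) ≡ nothing
    zero-on-E e∈ = negative-closed-zero lbl (cons {s = step _ true} refl chain) (All.lookup sat (E⊆I e∈) ∷ F-sat inF)
      (negative-fundamental F⊆I free (E⊆I e∈) (E#F e∈) (fundamental e∈)) (here refl)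
      where open Fundamental (fundamental e∈)

    one-per-tree : ∀ {e e′} → e ∈ E → e′ ∈ E → e ≢ e′ → class (Edge.x (lab e)) ≢ class (Edge.x (lab e′))
    one-per-tree e∈ e′∈ e≢e′ eq with walk (trans (sym (E-class e′∈)) (trans (sym eq) (E-class e∈)))
    ... | _ , c , c⊆F = no-two-cycles F⊆I free (E⊆I e∈) (E⊆I e′∈) (E#F e∈) (E#F e′∈) e≢e′
                          (fundamental e∈) (fundamental e′∈) c c⊆F

    place : Fin k ⊎ Fin (length E) → Fin k′
    place (inj₁ i) = class (labelRep i)
    place (inj₂ j) = class (Edge.x (lab (lookup E j)))

    -- Labels within a tree agree up to sign, so a zero and a basis vector cannot occur in the same
    -- tree.
    separate : ∀ i j → place (inj₁ i) ≢ place (inj₂ j)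
    separate i j eq with walk eq
    ... | p , c , p⊆F with trans (sym (lbl-rep i))
            (act-zero lbl (chainSign p) (sat-chain lbl c (F-sat p⊆F)) (zero-on-E (∈-lookup j)))
    ...   | ()

    place-inj : ∀ a b → place a ≡ place b → a ≡ b
    -- Two representatives in one tree carry the same basis vector up to sign.
    place-inj (inj₁ i) (inj₁ i′) eq with walk eq
    ... | p , c , p⊆F with trans (sym (lbl-rep i)) (trans (sat-chain lbl c (F-sat p⊆F))
            (cong (act (chainSign p)) (lbl-rep i′)))
    ...   | q = cong inj₁ (label≡ q)
      where
      label≡ : ∀ {s t} {i j : Fin k} → _≡_ {A = Val k} (just (s , i)) (just (t , j)) → i ≡ j
      label≡ refl = refl
    place-inj (inj₁ i) (inj₂ j) eq = ⊥-elim (separate i j eq)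
    place-inj (inj₂ j) (inj₁ i) eq = ⊥-elim (separate i j (sym eq))
    place-inj (inj₂ j) (inj₂ j′) eq with j ≟ j′
    ... | yes refl = refl
    ... | no j≢j′  = ⊥-elim (one-per-tree (∈-lookup j) (∈-lookup j′) (j≢j′ ∘ lookup-injective E-unique j j′) eq)

    place-injective : ∀ {a b : Fin (k + length E)} → place (splitAt k a) ≡ place (splitAt k b) → a ≡ b
    place-injective {a} {b} eq = trans (sym (join-splitAt k (length E) a))
      (trans (cong (join k (length E)) (place-inj (splitAt k a) (splitAt k b) eq)) (join-splitAt k (length E) b))

  -- Ranks

  record Basis (L : List X) : Set where
    field
      {k}     : ℕ
      B       : List X
      labels  : Labels n k
      stairs  : Staircase B
      B⊆L     : ∀ {e} → e ∈ B → e ∈ L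
      rank    : length B + k ≡ n
      sat     : All (Sat (Labels.lbl labels) ∘ lab) L

  -- The greedy step: `e` enters `B` exactly when the current quotient does not kill it, and the
  -- dimension `k` then drops by one.
  extendBasis : ∀ e {L} → Basis L → Basis (e ∷ L)
  extendBasis e record { B = B ; labels = labels ; stairs = stairs ; B⊆L = B⊆L ; rank = rank ; sat = sat }
    with Labels.lbl labels (Edge.x (lab e)) ≟ᵥ act (edgeSign (lab e)) (Labels.lbl labels (Edge.y (lab e)))
  ... | yes e-sat = record
        { B = B ; labels = labels ; stairs = stairs ; B⊆L = there ∘ B⊆L ; rank = rank ; sat = e-sat ∷ sat }
  ... | no unsat with addEdge labels (lab e) unsat
  ...   | k′ , refl , labels′ , e-sat , preserves = record
          { B = e ∷ B ; labels = labels′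
          -- The labelling from before the elimination kills all of `B` but not `e`.
          ; stairs = (_ , Labels.lbl labels , All.tabulate (All.lookup sat ∘ B⊆L) , unsat) ∷ stairs
          ; B⊆L = λ { (here eq) → here eq ; (there f∈) → there (B⊆L f∈) }
          ; rank = trans (sym (+-suc (length B) k′)) rank
          ; sat = e-sat ∷ All.map (λ {f} → preserves (lab f)) sat }

  basis : ∀ L → Basis L
  basis [] = record
    { B = [] ; labels = record { lbl = λ v → just (plus , v) ; rep = id ; lbl-rep = λ _ → refl }
    ; stairs = [] ; B⊆L = λ () ; rank = refl ; sat = [] }
  basis (e ∷ L) = extendBasis e (basis L)

  -- The quotient kills all of `S`, so every circuit-free list in `S` obeys the bound that `B`
  -- attains. As `S` may exceed the set from which `B` was chosen, one basis serves several ground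
  -- sets.
  staircase-rank : ∀ {S : X → Set} {B k r} (L : Labels n k) → Staircase B → All S B →
    length B ≡ r → r + k ≡ n → (∀ e → S e → Sat (Labels.lbl L) (lab e)) → IsRank S r
  staircase-rank {k = k} L stairs B⊆S length≡ rank sat =
    (_ , (staircase-unique stairs , B⊆S , staircase-circuit-free stairs) , length≡) ,
    λ I (u , I⊆S , free) → +-cancelʳ-≤ k _ _
      (subst (length I + k ≤_) (sym rank) (circuit-free-bound L u free (All.map (λ {e} → sat e) I⊆S)))

  bwalk-sat : ∀ {k} (h : Labelling n k) {S a α b β} → (∀ e → S e → Sat h (lab e)) →
    BWalk S a α b β → Sat h (mkEdge a α b β)
  bwalk-sat h {S} sat w = subst₄ (along linked inS) start startSign stop stopSign
    where
    open BWalk w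
    subst₄ : ∀ {a a′ α α′ b b′ β β′} → Sat h (mkEdge a α b β) → a ≡ a′ → α ≡ α′ → b ≡ b′ → β ≡ β′ →
      Sat h (mkEdge a′ α′ b′ β′)
    subst₄ p refl refl refl refl = p
    sgn-step : ∀ s → sgn s ≡ neg (srcSign s · tgtSign s)
    sgn-step (step e true)  = refl
    sgn-step (step e false) = cong neg (·-comm (Edge.α (lab e)) (Edge.β (lab e)))
    -- The inner sign `b` cancels as a square, and its negation absorbs one of the two outer minus
    -- signs.
    compose : ∀ a b d → neg (a · neg b) · neg (b · d) ≡ neg (a · d)
    compose plus  plus  plus  = refl
    compose plus  plus  minus = refl
    compose plus  minus plus  = refl
    compose plus  minus minus = refl
    compose minus plus  plus  = refl
    compose minus plus  minus = refl
    compose minus minus plus  = refl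
    compose minus minus minus = refl
    one : ∀ s → S (Step.edge s) → h (src s) ≡ act (neg (srcSign s · tgtSign s)) (h (tgt s))
    one s s∈ = trans (sat-step h s (sat _ s∈)) (cong (λ σ → act σ (h (tgt s))) (sgn-step s))
    along : ∀ {s ss} → Linked BAdj (s ∷ ss) → All (S ∘ Step.edge) (s ∷ ss) →
      Sat h (mkEdge (src s) (srcSign s) (tgt (lastOf s ss)) (tgtSign (lastOf s ss)))
    along {s} [-] (s∈ ∷ []) = one s s∈
    along {s} {t ∷ ss} ((adj , opp) ∷ l) (s∈ ∷ rest∈) = trans (one s s∈)
      (trans (cong (act _) (trans (cong h adj) (along l rest∈)))
      (trans (act-· _ _ (h (tgt (lastOf t ss)))) (cong (λ σ → act σ (h (tgt (lastOf t ss))))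
        (trans (cong (λ σ → neg (srcSign s · σ) · neg (srcSign t · tgtSign (lastOf t ss))) opp)
          (compose (srcSign s) (srcSign t) _)))))

reverse-sat : ∀ {n k} (h : Labelling n k) e →
  Sat h (mkEdge (Edge.y e) (Edge.β e) (Edge.x e) (Edge.α e)) → Sat h e
reverse-sat h (mkEdge x α y β) p =
  trans (act-flip (neg (β · α)) p) (cong (λ σ → act (neg σ) (h y)) (·-comm β α))

-- One basis for all three matroids

module _ (G : BiGraph) where
  open BiGraph G
  open Chains

  -- The separating labellings live on the vertices, which the transitive closure shares with `G`.
  liftStaircase : ∀ {B} → Staircase edge B → Staircase (ftLab G) (map inj₁ B)
  liftStaircase []                             = []
  liftStaircase ((k , h , sat , unsat) ∷ stairs) = (k , h , Allₚ.map⁺ sat , unsat) ∷ liftStaircase stairs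

theorem57 : (G : BiGraph) (R : Subset (BiGraph.m G)) → IsTransitiveReduction G R →
    Σ ℕ (λ k → RankFt G k × RankG G k × RankPartial G R k)
theorem57 G R (covers , _) = length B ,
  staircase-rank (ftLab G) labels (liftStaircase G stairs) (Allₚ.map⁺ (All.universal _ B))
    (length-map inj₁ B) rank satFt ,
  staircase-rank edge labels stairs (All.universal _ B) refl rank (λ e _ → satG e) ,
  staircase-rank edge labels stairs (All.tabulate (λ e∈ → proj₂ (∈-filter⁻ (_∈ₛ? R) {xs = allFin m} (B⊆L e∈)))) refl rank satR
  where
  open BiGraph G
  open Chains
  -- The basis is chosen among the edges of `R`, the smallest of the three ground sets.
  open Basis (basis edge (filter (_∈ₛ? R) (allFin m)))
  h = Labels.lbl labels
  satR : ∀ e → e ∈ₛ R → Sat h (edge e)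
  satR e e∈R = All.lookup sat (∈-filter⁺ (_∈ₛ? R) (∈-allFin e) e∈R)
  satG : ∀ e → Sat h (edge e)
  satG e with covers e
  ... | inj₁ e∈R              = satR e e∈R
  ... | inj₂ (inj₁ (w , _)) = bwalk-sat edge h satR w
  -- The b-path may run from the second end to the first, which gives the same equation read
  -- backwards.
  ... | inj₂ (inj₂ (w , _)) = reverse-sat h (edge e) (bwalk-sat edge h satR w)
  satFt : ∀ q → FtGround G q → Sat h (ftLab G q)
  satFt (inj₁ e) _       = satG e
  satFt (inj₂ q) (w , _) = bwalk-sat edge h (λ e _ → satG e) w
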